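{- For any finite simple graph $G$ with $m$ edges which is not a linear forest, $c_2(G)\leq m-1$.
   Context: All graphs are finite and simple. A subgraph complementation system for a graph $G=(V,E)$ is a finite collection (family) $\mathscr{C}$ of subsets of $V$ such that, for any two distinct vertices $u,v\in V$, $uv\in E$ if and only if $u$ and $v$ appear together in an odd number of sets in $\mathscr{C}$. The subgraph complementation number $c_2(G)$ is the minimum cardinality of a subgraph complementation system for $G$. A linear forest is a graph every connected component of which is a path (a single vertex counts as a path). -}

module Defs where

open import Data.Nat.Base as ℕ using (ℕ; zero; suc; z≤n; s≤s; _%_)
import Data.Nat.Properties as ℕ
open import Data.Fin.Base using (Fin; toℕ; _<_)
import Data.Fin.Properties as Fin
open import Data.Fin.Subset using (Subset; ⁅_⁆; _∪_; _∈_)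
open import Data.Fin.Subset.Properties
  using (_∈?_; anySubset?; x∈⁅x⁆; x∈⁅y⁆⇒x≡y; x∈p∪q⁻; x∈p∪q⁺)
open import Data.List.Base as List using (List; []; _∷_; length; allFin; cartesianProduct)
open import Data.List.Relation.Unary.All using (All; []; _∷_)
import Data.List.Relation.Unary.All as All
open import Data.List.Relation.Unary.Any using (here; there)
import Data.List.Membership.Propositional as ListM
import Data.List.Membership.Propositional.Properties as ListM
open import Data.List.Relation.Unary.Unique.Propositional using (Unique; []; _∷_)
import Data.List.Relation.Unary.Unique.Propositional.Properties as Unique
open import Data.Vec.Base as Vec using (Vec; []; _∷_; count)
open import Data.Product.Base using (Σ; ∃; _×_; _,_; proj₁; proj₂)
open import Data.Sum.Base using (_⊎_; inj₁; inj₂; swap)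
open import Function.Base using (_∘_)
open import Function.Bundles using (_⇔_; mk⇔; module Equivalence)
open import Function.Definitions using (Injective)
open import Level using (0ℓ)
open import Relation.Binary.Core using (Rel)
open import Relation.Binary.Definitions
  using (Decidable; Symmetric; Irreflexive; tri<; tri≈; tri>)
open import Relation.Binary.Construct.Closure.ReflexiveTransitive using (Star)
open import Relation.Binary.PropositionalEquality
open import Relation.Nullary using (Dec; yes; no; ¬_; contradiction)
open import Relation.Nullary.Decidable as Dec using (_×-dec_; _⊎-dec_; _→-dec_; ¬?)
import Relation.Unary as U

record Graph (n : ℕ) : Set₁ where
  field
    Adj        : Rel (Fin n) 0ℓ
    adj?       : Decidable Adj
    adj-sym    : Symmetric Adj
    adj-irrefl : Irreflexive _≡_ Adj

open Graph public using (Adj; adj?; adj-sym; adj-irrefl)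

-- Each edge is listed exactly once, as the pair (u , v) with u < v.

edges : ∀ {n} → Graph n → List (Fin n × Fin n)
edges {n} G = List.filter (λ (u , v) → u Fin.<? v ×-dec adj? G u v)
                          (cartesianProduct (allFin n) (allFin n))

numEdges : ∀ {n} → Graph n → ℕ
numEdges G = length (edges G)

------------------------------------------------------------------------
-- Linear forests

pathGraph : ∀ k → Graph k
pathGraph k = record
  { Adj        = λ i j → toℕ j ≡ suc (toℕ i) ⊎ toℕ i ≡ suc (toℕ j)
  ; adj?       = λ i j → (toℕ j ℕ.≟ suc (toℕ i)) ⊎-dec (toℕ i ℕ.≟ suc (toℕ j))
  ; adj-sym    = swap
  ; adj-irrefl = λ { refl (inj₁ e) → ℕ.1+n≢n (sym e) ; refl (inj₂ e) → ℕ.1+n≢n (sym e) }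
  }

Component : ∀ {n} → Graph n → Fin n → U.Pred (Fin n) 0ℓ
Component G v w = Star (Adj G) v w

-- The subgraph induced on C is isomorphic to H.

record _[_]≅_ {n k} (G : Graph n) (C : U.Pred (Fin n) 0ℓ) (H : Graph k) : Set where
  field
    to        : Fin k → Fin n
    injective : Injective _≡_ _≡_ to
    image     : ∀ w → C w ⇔ (∃ λ i → to i ≡ w)
    adjacency : ∀ i j → Adj H i j ⇔ Adj G (to i) (to j)

IsLinearForest : ∀ {n} → Graph n → Set
IsLinearForest G = ∀ v → ∃ λ k → G [ Component G v ]≅ pathGraph k

------------------------------------------------------------------------
-- Subgraph complementation systems

-- A family of k subsets may contain repetitions. Deleting two equal members
-- leaves all parities unchanged, so the minimum is the same as over sets of
-- subsets.

together : ∀ {n k} → Vec (Subset n) k → Fin n → Fin n → ℕ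
together C u v = count (λ S → (u ∈? S) ×-dec (v ∈? S)) C

Odd : ℕ → Set
Odd m = m % 2 ≡ 1

IsSystem : ∀ {n k} → Graph n → Vec (Subset n) k → Set
IsSystem G C = ∀ u v → u ≢ v → Adj G u v ⇔ Odd (together C u v)

HasSystem : ∀ {n} → Graph n → ℕ → Set
HasSystem {n} G k = Σ (Vec (Subset n) k) (IsSystem G)

------------------------------------------------------------------------
-- The minimum size of a system exists: having a system of size k is
-- decidable, and the two-element sets {u , v} for edges uv form a system.

private
  ⇔-dec : ∀ {A B : Set} → Dec A → Dec B → Dec (A ⇔ B)
  ⇔-dec a? b? = Dec.map′ (λ (f , g) → mk⇔ f g)
                         (λ e → Equivalence.to e , Equivalence.from e)
                         ((a? →-dec b?) ×-dec (b? →-dec a?))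

  isSystem? : ∀ {n k} (G : Graph n) (C : Vec (Subset n) k) → Dec (IsSystem G C)
  isSystem? G C = Fin.all? λ u → Fin.all? λ v →
    ¬? (u Fin.≟ v) →-dec ⇔-dec (adj? G u v) (together C u v % 2 ℕ.≟ 1)

  anyFamily? : ∀ {n} k {P : U.Pred (Vec (Subset n) k) 0ℓ} → U.Decidable P → Dec (∃ P)
  anyFamily? zero    P? = Dec.map′ ([] ,_) (λ { ([] , p) → p }) (P? [])
  anyFamily? (suc k) P? = Dec.map′
    (λ (S , C , p) → S ∷ C , p)
    (λ { (S ∷ C , p) → S , C , p })
    (anySubset? λ S → anyFamily? k (P? ∘ (S ∷_)))

hasSystem? : ∀ {n} (G : Graph n) → U.Decidable (HasSystem G)
hasSystem? G k = anyFamily? k (isSystem? G)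

edgeFamily : ∀ {n} (es : List (Fin n × Fin n)) → Vec (Subset n) (length es)
edgeFamily es = Vec.map (λ (u , v) → ⁅ u ⁆ ∪ ⁅ v ⁆) (Vec.fromList es)

private
  ∈-pair⁻ : ∀ {n} {x u v : Fin n} → x ∈ ⁅ u ⁆ ∪ ⁅ v ⁆ → x ≡ u ⊎ x ≡ v
  ∈-pair⁻ {u = u} {v} p with x∈p∪q⁻ ⁅ u ⁆ ⁅ v ⁆ p
  ... | inj₁ q = inj₁ (x∈⁅y⁆⇒x≡y u q)
  ... | inj₂ q = inj₂ (x∈⁅y⁆⇒x≡y v q)

  pair-unique : ∀ {n} {x y u v : Fin n} → x < y → u < v →
                x ∈ ⁅ u ⁆ ∪ ⁅ v ⁆ → y ∈ ⁅ u ⁆ ∪ ⁅ v ⁆ → (x , y) ≡ (u , v)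
  pair-unique x<y u<v p q with ∈-pair⁻ p | ∈-pair⁻ q
  ... | inj₁ refl | inj₁ refl = contradiction x<y (ℕ.<-irrefl refl)
  ... | inj₁ refl | inj₂ refl = refl
  ... | inj₂ refl | inj₁ refl = contradiction x<y (ℕ.<-asym u<v)
  ... | inj₂ refl | inj₂ refl = contradiction x<y (ℕ.<-irrefl refl)

  Ordered : ∀ {n} → Fin n × Fin n → Set
  Ordered (u , v) = u < v

  module _ {n k} {x y : Fin n} {S : Subset n} (C : Vec (Subset n) k) where
    together-both : x ∈ S × y ∈ S → together (S ∷ C) x y ≡ suc (together C x y)
    together-both (p , q) with x ∈? S | y ∈? S
    ... | yes _ | yes _ = refl
    ... | no ¬p | _     = contradiction p ¬p
    ... | yes _ | no ¬q = contradiction q ¬q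

    together-skip : ¬ (x ∈ S × y ∈ S) → together (S ∷ C) x y ≡ together C x y
    together-skip ¬pq with x ∈? S | y ∈? S
    ... | yes p | yes q = contradiction (p , q) ¬pq
    ... | no _  | _     = refl
    ... | yes _ | no _  = refl

  together-∉ : ∀ {n} (es : List (Fin n × Fin n)) {x y} → x < y → All Ordered es →
               ¬ ((x , y) ListM.∈ es) → together (edgeFamily es) x y ≡ 0
  together-∉ [] _ _ _ = refl
  together-∉ (_ ∷ es) x<y (u<v ∷ os) ∉ = trans
    (together-skip (edgeFamily es) λ (p , q) → ∉ (here (pair-unique x<y u<v p q)))
    (together-∉ es x<y os (∉ ∘ there))

  together-∈ : ∀ {n} (es : List (Fin n × Fin n)) {x y} → x < y → All Ordered es → Unique es →
               (x , y) ListM.∈ es → together (edgeFamily es) x y ≡ 1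
  together-∈ (_ ∷ es) {x} {y} x<y (_ ∷ os) (≢s ∷ _) (here refl) = trans
    (together-both (edgeFamily es)
      (x∈p∪q⁺ (inj₁ (x∈⁅x⁆ x)) , x∈p∪q⁺ {p = ⁅ x ⁆} (inj₂ (x∈⁅x⁆ y))))
    (cong suc (together-∉ es x<y os λ i → All.lookup ≢s i refl))
  together-∈ (_ ∷ es) x<y (u<v ∷ os) (≢s ∷ un) (there i) = trans
    (together-skip (edgeFamily es) λ (p , q) →
      All.lookup ≢s i (sym (pair-unique x<y u<v p q)))
    (together-∈ es x<y os un i)

  together-sym : ∀ {n k} (C : Vec (Subset n) k) u v → together C u v ≡ together C v u
  together-sym []      u v = refl
  together-sym (S ∷ C) u v with u ∈? S | v ∈? S
  ... | yes _ | yes _ = cong suc (together-sym C u v)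
  ... | yes _ | no  _ = together-sym C u v
  ... | no  _ | yes _ = together-sym C u v
  ... | no  _ | no  _ = together-sym C u v

  module _ {n} (G : Graph n) where
    isEdge? : U.Decidable λ ((u , v) : Fin n × Fin n) → u < v × Adj G u v
    isEdge? (u , v) = u Fin.<? v ×-dec adj? G u v

    ∈-edges⁺ : ∀ {u v} → u < v → Adj G u v → (u , v) ListM.∈ edges G
    ∈-edges⁺ {u} {v} u<v a = ListM.∈-filter⁺ isEdge?
      (ListM.∈-cartesianProduct⁺ (ListM.∈-allFin u) (ListM.∈-allFin v)) (u<v , a)

    ∈-edges⁻ : ∀ {e} → e ListM.∈ edges G → proj₁ e < proj₂ e × Adj G (proj₁ e) (proj₂ e)
    ∈-edges⁻ i = proj₂ (ListM.∈-filter⁻ isEdge?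
      {xs = cartesianProduct (allFin n) (allFin n)} i)

    ordered : All Ordered (edges G)
    ordered = All.tabulate (proj₁ ∘ ∈-edges⁻)

    unique : Unique (edges G)
    unique = Unique.filter⁺ isEdge?
      (Unique.cartesianProduct⁺ (Unique.allFin⁺ n) (Unique.allFin⁺ n))

    system-< : ∀ {u v} → u < v → Adj G u v ⇔ Odd (together (edgeFamily (edges G)) u v)
    system-< {u} {v} u<v with adj? G u v
    ... | yes a = mk⇔ (λ _ → cong (_% 2) (together-∈ (edges G) u<v ordered unique (∈-edges⁺ u<v a)))
                      (λ _ → a)
    ... | no ¬a = mk⇔ (λ a → contradiction a ¬a)
      (λ odd → contradiction
        (trans (sym odd) (cong (_% 2) (together-∉ (edges G) u<v ordered (¬a ∘ proj₂ ∘ ∈-edges⁻))))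
        λ ())

edgeFamily-isSystem : ∀ {n} (G : Graph n) → IsSystem G (edgeFamily (edges G))
edgeFamily-isSystem G u v u≢v with Fin.<-cmp u v
... | tri< u<v _ _ = system-< G u<v
... | tri≈ _ u≡v _ = contradiction u≡v u≢v
... | tri> _ _ v<u = mk⇔
  (λ a → subst Odd (together-sym F v u) (Equivalence.to (system-< G v<u) (adj-sym G a)))
  (λ o → adj-sym G (Equivalence.from (system-< G v<u) (subst Odd (together-sym F u v) o)))
  where F = edgeFamily (edges G)

Least : (ℕ → Set) → ℕ → Set
Least P k = P k × (∀ j → P j → k ℕ.≤ j)

least : ∀ {P : ℕ → Set} → U.Decidable P → ∀ b → P b → ∃ (Least P)
least P? b pb with P? 0
... | yes p0 = 0 , p0 , λ _ _ → z≤n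
least P? zero    pb | no ¬p0 = contradiction pb ¬p0
least P? (suc b) pb | no ¬p0 with k , pk , min ← least (P? ∘ suc) b pb =
  suc k , pk , λ { zero p → contradiction p ¬p0 ; (suc j) p → s≤s (min j p) }

private
  minimum : ∀ {n} (G : Graph n) → ∃ (Least (HasSystem G))
  minimum G = least (hasSystem? G) (numEdges G) (edgeFamily (edges G) , edgeFamily-isSystem G)

c₂ : ∀ {n} → Graph n → ℕ
c₂ G = proj₁ (minimum G)

c₂-least : ∀ {n} (G : Graph n) → Least (HasSystem G) (c₂ G)
c₂-least G = proj₂ (minimum G)

{-# OPTIONS --safe #-}
-- Over 𝔽₂ a set S contributes the matrix S Sᵀ, read off the diagonal, and a
-- system is a sum of such matrices equal to the adjacency matrix. Three edges
-- va, vb, vc at one vertex can be replaced by the two sets vabc and abc, and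
-- the k edges of a cycle by the k − 2 triangles of a fan, so in either case
-- the system of all edges can be shortened. A graph with neither three edges
-- at a vertex nor a cycle is a linear forest, because a maximal path through
-- a vertex exhausts the component of that vertex.
module Submission where

open import Defs
open import Data.Bool.Base using (Bool; true; false; not; _∧_; _∨_; _xor_)
open import Data.Bool.Properties using (not-involutive; xor-assoc; xor-comm; xor-identityʳ)
open import Data.Bool.Solver using (module xor-∧-Solver)
open import Data.Fin.Base as Fin using (Fin; zero; suc; toℕ)
import Data.Fin.Properties as Fin
open import Data.Fin.Subset using (Subset; ⁅_⁆; _∪_)
open import Data.Fin.Subset.Properties as Subset using (x∈⁅y⁆⇒x≡y; ∪-comm)
open import Data.List.Base using (List; []; _∷_; [_]; _++_; length; lookup; map)
open import Data.List.Properties using (length-++; length-map; map-++)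
import Data.List.Membership.DecPropositional as DecMembership
open import Data.List.Membership.Propositional using (_∈_; _∉_; find; lose)
open import Data.List.Membership.Propositional.Properties
  using (∈-filter⁺; ∈-cartesianProduct⁺; ∈-allFin; ∈-lookup; ∈-∃++; ∈-++⁺ˡ)
open import Data.List.Relation.Binary.Permutation.Propositional
  using (_↭_; refl; prep; swap; trans)
open import Data.List.Relation.Binary.Permutation.Propositional.Properties
  using (map⁺; ↭-length; shift; ∈-resp-↭)
open import Data.List.Relation.Unary.All as All using (All; []; _∷_)
open import Data.List.Relation.Unary.All.Properties using (¬Any⇒All¬)
open import Data.List.Relation.Unary.AllPairs using ([]; _∷_)
open import Data.List.Relation.Unary.Any as Any using (here; there)
open import Data.List.Relation.Unary.Any.Properties using (lookup-index)
open import Data.List.Relation.Unary.Linked using (Linked; [-]; _∷_)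
open import Data.List.Relation.Unary.Unique.Propositional using (Unique)
import Data.List.Relation.Unary.Unique.Propositional.Properties as Unique
open import Data.Nat.Base using (ℕ; zero; suc; _+_; _≤_; _<_; s≤s)
import Data.Nat.Properties as ℕ
open import Data.Product.Base using (∃; _×_; _,_; proj₁; proj₂)
open import Data.Sum.Base using (_⊎_; inj₁; inj₂)
open import Data.Vec.Base as Vec using (Vec; []; _∷_; toList; fromList)
open import Data.Vec.Properties
  using (lookup⇒[]=; lookup-zipWith; toList-map; toList∘fromList)
open import Function.Base using (_∘_)
open import Function.Bundles using (_⇔_; mk⇔; module Equivalence)
open import Relation.Binary.Construct.Closure.ReflexiveTransitive using (Star; ε; _◅_; _◅◅_; reverse)
open import Relation.Binary.Definitions using (tri<; tri≈; tri>)
open import Relation.Binary.PropositionalEquality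
  using (_≡_; _≢_; refl; sym; cong; cong₂; subst; module ≡-Reasoning)
  renaming (trans to ≡-trans)
open import Relation.Nullary using (¬_; Dec; yes; no; does; contradiction)
open import Relation.Nullary.Decidable using (_×-dec_; ¬?; decidable-stable)

private
  variable
    n : ℕ

-- Parity of a family of subsets

quad : Subset n → Fin n → Fin n → Bool
quad S u v = Vec.lookup S u ∧ Vec.lookup S v

parity : List (Subset n) → Fin n → Fin n → Bool
parity []       u v = false
parity (S ∷ Ss) u v = quad S u v xor parity Ss u v

-- `Odd` is stated through `%`. Here each counted set becomes a `not`, so counting turns into
-- addition over 𝔽₂, which a Boolean ring solver can handle.
odd : ℕ → Bool
odd zero    = false
odd (suc m) = not (odd m)

odd-correct : ∀ m → Odd m ⇔ odd m ≡ true
odd-correct zero          = mk⇔ (λ ()) (λ ())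
odd-correct (suc zero)    = mk⇔ (λ _ → refl) (λ _ → refl)
-- `suc (suc m) % 2` computes to `m % 2`, so only the double negation has to be removed.
odd-correct (suc (suc m)) rewrite not-involutive (odd m) = odd-correct m

does-∈? : ∀ (x : Fin n) S → does (x Subset.∈? S) ≡ Vec.lookup S x
does-∈? zero    (true  ∷ S) = refl
does-∈? zero    (false ∷ S) = refl
does-∈? (suc x) (_     ∷ S) = does-∈? x S

odd-together : ∀ {k} (C : Vec (Subset n) k) u v → odd (together C u v) ≡ parity (toList C) u v
odd-together []      u v = refl
odd-together (S ∷ C) u v
  -- Turning the lookups into the test on which `count` branches lets one case split compute both
  -- sides.
  rewrite sym (does-∈? u S) | sym (does-∈? v S) | sym (odd-together C u v)
  with does (u Subset.∈? S) ∧ does (v Subset.∈? S)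
... | true  = refl
... | false = refl

parity-++ : ∀ (Ss Ts : List (Subset n)) u v →
            parity (Ss ++ Ts) u v ≡ parity Ss u v xor parity Ts u v
parity-++ []       Ts u v = refl
parity-++ (S ∷ Ss) Ts u v =
  ≡-trans (cong (quad S u v xor_) (parity-++ Ss Ts u v)) (sym (xor-assoc (quad S u v) _ _))

parity-↭ : ∀ {Ss Ts : List (Subset n)} → Ss ↭ Ts → ∀ u v → parity Ss u v ≡ parity Ts u v
parity-↭ refl          u v = refl
parity-↭ (prep S p)    u v = cong (quad S u v xor_) (parity-↭ p u v)
parity-↭ (trans p q)   u v = ≡-trans (parity-↭ p u v) (parity-↭ q u v)
parity-↭ (swap {xs = Ss} {ys = Ts} S T p) u v = begin
  s xor (t xor parity Ss u v)  ≡⟨ cong (λ b → s xor (t xor b)) (parity-↭ p u v) ⟩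
  s xor (t xor parity Ts u v)  ≡⟨ xor-assoc s t _ ⟨
  (s xor t) xor parity Ts u v  ≡⟨ cong (_xor parity Ts u v) (xor-comm s t) ⟩
  (t xor s) xor parity Ts u v  ≡⟨ xor-assoc t s _ ⟩
  t xor (s xor parity Ts u v)  ∎
  where
  open ≡-Reasoning
  s = quad S u v
  t = quad T u v

pair : Fin n × Fin n → Subset n
pair (u , v) = ⁅ u ⁆ ∪ ⁅ v ⁆

toList-edgeFamily : ∀ (es : List (Fin n × Fin n)) → toList (edgeFamily es) ≡ map pair es
toList-edgeFamily es =
  ≡-trans (toList-map pair (fromList es)) (cong (map pair) (toList∘fromList es))

-- Replacing edges by fewer sets

-- Each element of `xs` is cut out of `ys` in turn. As `xs` has no repetitions, the occurrence
-- removed for one element is never the one required by a later element.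
unique⇒↭-++ : ∀ {A : Set} {xs ys : List A} → Unique xs → All (_∈ ys) xs → ∃ λ zs → ys ↭ xs ++ zs
unique⇒↭-++ {ys = ys} [] [] = ys , refl
unique⇒↭-++ {xs = x ∷ xs} {ys} (x≢xs ∷ u) (x∈ys ∷ xs∈ys) with ∈-∃++ x∈ys
... | as , bs , refl =
  let ys↭            = shift x as bs
      zs , as++bs↭   = unique⇒↭-++ u (All.tabulate λ y∈xs →
                         remaining (All.lookup x≢xs y∈xs) (∈-resp-↭ ys↭ (All.lookup xs∈ys y∈xs)))
  in zs , trans ys↭ (prep x as++bs↭)
  where
  remaining : ∀ {y} → x ≢ y → y ∈ x ∷ as ++ bs → y ∈ as ++ bs
  remaining x≢y (here y≡x)  = contradiction (sym y≡x) x≢y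
  remaining _   (there y∈)  = y∈

isSystem-resp-parity : ∀ (G : Graph n) {k l} (C : Vec (Subset n) k) (D : Vec (Subset n) l) →
  (∀ u v → u ≢ v → parity (toList C) u v ≡ parity (toList D) u v) → IsSystem G C → IsSystem G D
isSystem-resp-parity G C D eq sys u v u≢v = mk⇔
  (λ a → from (odd-correct (together D u v))
           (≡-trans (sym same) (to (odd-correct (together C u v)) (to (sys u v u≢v) a))))
  (λ o → from (sys u v u≢v) (from (odd-correct (together C u v))
           (≡-trans same (to (odd-correct (together D u v)) o))))
  where
  open Equivalence
  same : odd (together C u v) ≡ odd (together D u v)
  same = ≡-trans (odd-together C u v) (≡-trans (eq u v u≢v) (sym (odd-together D u v)))

-- Bring `es` to the front of the edge list, put `Rs` in its place and keep the remaining edges. The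
-- result is again a system, and minimality bounds `c₂ G` by its length. Agreement is asked only for
-- `u ≢ v` because a system does not constrain the diagonal; both savings below exploit this
-- freedom.
exchange : ∀ (G : Graph n) es Rs → Unique es → All (_∈ edges G) es →
           (∀ u v → u ≢ v → parity (map pair es) u v ≡ parity Rs u v) →
           length Rs < length es → c₂ G < numEdges G
exchange G es Rs un es∈ eq shorter = begin-strict
  c₂ G                            ≤⟨ proj₂ (c₂-least G) _ (fromList Ss , system) ⟩
  length Ss                       ≡⟨ ≡-trans (length-++ Rs) (cong (length Rs +_) (length-map pair rest)) ⟩
  length Rs + length rest         <⟨ ℕ.+-monoˡ-< (length rest) shorter ⟩
  length es + length rest         ≡⟨ length-++ es ⟨
  length (es ++ rest)             ≡⟨ ↭-length edges↭ ⟨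
  numEdges G                      ∎
  where
  open ℕ.≤-Reasoning
  rest    = proj₁ (unique⇒↭-++ un es∈)
  edges↭  = proj₂ (unique⇒↭-++ un es∈)
  Ss      = Rs ++ map pair rest

  parities : ∀ u v → u ≢ v → parity (toList (edgeFamily (edges G))) u v ≡ parity (toList (fromList Ss)) u v
  parities u v u≢v = R.begin
    parity (toList (edgeFamily (edges G))) u v             R.≡⟨ cong (λ Ts → parity Ts u v) (toList-edgeFamily (edges G)) ⟩
    parity (map pair (edges G)) u v                        R.≡⟨ parity-↭ (map⁺ pair edges↭) u v ⟩
    parity (map pair (es ++ rest)) u v                     R.≡⟨ cong (λ Ts → parity Ts u v) (map-++ pair es rest) ⟩
    parity (map pair es ++ map pair rest) u v              R.≡⟨ parity-++ (map pair es) _ u v ⟩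
    parity (map pair es) u v xor parity (map pair rest) u v R.≡⟨ cong (_xor parity (map pair rest) u v) (eq u v u≢v) ⟩
    parity Rs u v xor parity (map pair rest) u v           R.≡⟨ parity-++ Rs _ u v ⟨
    parity Ss u v                                          R.≡⟨ cong (λ Ts → parity Ts u v) (toList∘fromList Ss) ⟨
    parity (toList (fromList Ss)) u v                      R.∎
    where module R = ≡-Reasoning

  system : IsSystem G (fromList Ss)
  system = isSystem-resp-parity G (edgeFamily (edges G)) (fromList Ss) parities (edgeFamily-isSystem G)

-- Edges as ordered pairs

-- `edges` lists the smaller endpoint first, whereas claws and paths supply edges in either
-- direction.
orient : Fin n → Fin n → Fin n × Fin n
orient u v with u Fin.<? v
... | yes _ = u , v
... | no  _ = v , u

<∧Adj⇒∈-edges : ∀ (G : Graph n) {u v} → u Fin.< v → Adj G u v → (u , v) ∈ edges G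
<∧Adj⇒∈-edges G {u} {v} u<v a = ∈-filter⁺ (λ (x , y) → x Fin.<? y ×-dec adj? G x y)
  (∈-cartesianProduct⁺ (∈-allFin u) (∈-allFin v)) (u<v , a)

adj⇒≢ : ∀ (G : Graph n) {u v} → Adj G u v → u ≢ v
adj⇒≢ G a u≡v = adj-irrefl G u≡v a

orient-∈-edges : ∀ (G : Graph n) {u v} → Adj G u v → orient u v ∈ edges G
orient-∈-edges G {u} {v} a with u Fin.<? v
... | yes u<v = <∧Adj⇒∈-edges G u<v a
... | no  u≮v = <∧Adj⇒∈-edges G
  (ℕ.≤∧≢⇒< (ℕ.≮⇒≥ u≮v) (adj⇒≢ G a ∘ sym ∘ Fin.toℕ-injective)) (adj-sym G a)

-- Normalising forgets only the direction. The edges of a claw or a cycle are told apart through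
-- this lemma, by their endpoints.
orient-injective : ∀ {u v x y : Fin n} → orient u v ≡ orient x y →
                   (u ≡ x × v ≡ y) ⊎ (u ≡ y × v ≡ x)
orient-injective {u = u} {v} {x} {y} eq with u Fin.<? v | x Fin.<? y
orient-injective refl | yes _ | yes _ = inj₁ (refl , refl)
orient-injective refl | yes _ | no  _ = inj₂ (refl , refl)
orient-injective refl | no  _ | yes _ = inj₂ (refl , refl)
orient-injective refl | no  _ | no  _ = inj₁ (refl , refl)

orient-injectiveʳ : ∀ {u v w : Fin n} → orient u v ≡ orient u w → v ≡ w
orient-injectiveʳ eq with orient-injective eq
... | inj₁ (_ , v≡w)   = v≡w
... | inj₂ (u≡w , v≡u) = ≡-trans v≡u u≡w

pair-orient : ∀ (u v : Fin n) → pair (orient u v) ≡ ⁅ u ⁆ ∪ ⁅ v ⁆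
pair-orient u v with u Fin.<? v
... | yes _ = refl
... | no  _ = ∪-comm ⁅ v ⁆ ⁅ u ⁆

-- Off-diagonal identities for sums of singletons

infixr 6 _⊕_
-- Symmetric difference, which is the sum over 𝔽₂. Its entries expand by the ring laws, and on two
-- distinct singletons it agrees with the union.
_⊕_ : Subset n → Subset n → Subset n
_⊕_ = Vec.zipWith _xor_

lookup⁅⁆⇒≡ : ∀ (x : Fin n) {u} → Vec.lookup ⁅ x ⁆ u ≡ true → u ≡ x
lookup⁅⁆⇒≡ x {u} eq = x∈⁅y⁆⇒x≡y x (lookup⇒[]= u _ eq)

∧-false : ∀ p q → ¬ (p ≡ true × q ≡ true) → p ∧ q ≡ false
∧-false false _     _ = refl
∧-false true  false _ = refl
∧-false true  true  f = contradiction (refl , refl) f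

-- Two distinct vertices cannot both be `x`. The identities below hold up to such diagonal terms,
-- which this lemma discards.
quad-⁅⁆ : ∀ (x : Fin n) {u v} → u ≢ v → quad ⁅ x ⁆ u v ≡ false
quad-⁅⁆ x {u} {v} u≢v = ∧-false (Vec.lookup ⁅ x ⁆ u) (Vec.lookup ⁅ x ⁆ v)
  λ (p , q) → u≢v (≡-trans (lookup⁅⁆⇒≡ x p) (sym (lookup⁅⁆⇒≡ x q)))

∨≡xor : ∀ p q → p ∧ q ≡ false → p ∨ q ≡ p xor q
∨≡xor false q     _ = refl
∨≡xor true  false _ = refl

lookup-∪≡⊕ : ∀ {x y : Fin n} → x ≢ y → ∀ u → Vec.lookup (⁅ x ⁆ ∪ ⁅ y ⁆) u ≡ Vec.lookup (⁅ x ⁆ ⊕ ⁅ y ⁆) u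
lookup-∪≡⊕ {x = x} {y} x≢y u = begin
  Vec.lookup (⁅ x ⁆ ∪ ⁅ y ⁆) u                 ≡⟨ lookup-zipWith _∨_ u ⁅ x ⁆ ⁅ y ⁆ ⟩
  Vec.lookup ⁅ x ⁆ u ∨ Vec.lookup ⁅ y ⁆ u      ≡⟨ ∨≡xor (Vec.lookup ⁅ x ⁆ u) (Vec.lookup ⁅ y ⁆ u) disjoint ⟩
  Vec.lookup ⁅ x ⁆ u xor Vec.lookup ⁅ y ⁆ u    ≡⟨ lookup-zipWith _xor_ u ⁅ x ⁆ ⁅ y ⁆ ⟨
  Vec.lookup (⁅ x ⁆ ⊕ ⁅ y ⁆) u                 ∎
  where
  open ≡-Reasoning
  disjoint : Vec.lookup ⁅ x ⁆ u ∧ Vec.lookup ⁅ y ⁆ u ≡ false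
  disjoint = ∧-false (Vec.lookup ⁅ x ⁆ u) (Vec.lookup ⁅ y ⁆ u)
    λ (p , q) → x≢y (≡-trans (sym (lookup⁅⁆⇒≡ x p)) (lookup⁅⁆⇒≡ y q))

quad-pair-orient : ∀ {x y : Fin n} → x ≢ y → ∀ u v →
                   quad (pair (orient x y)) u v ≡ quad (⁅ x ⁆ ⊕ ⁅ y ⁆) u v
quad-pair-orient {x = x} {y} x≢y u v rewrite pair-orient x y =
  cong₂ _∧_ (lookup-∪≡⊕ x≢y u) (lookup-∪≡⊕ x≢y v)

module _ {u v : Fin n} where
  private
    q : Subset n → Bool
    q S = quad S u v

    lookup-⊕ : ∀ (S T : Subset n) w → Vec.lookup (S ⊕ T) w ≡ Vec.lookup S w xor Vec.lookup T w
    lookup-⊕ S T w = lookup-zipWith _xor_ w S T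

  -- Every mixed product occurs once on each side, while `q A`, `q B`, `q C` occur once on the left
  -- and twice on the right. Hence the sides differ exactly by `q A xor q B xor q C`.
  quad-triangle : ∀ {A B C : Subset n} → q A ≡ false → q B ≡ false → q C ≡ false →
                  q (A ⊕ B ⊕ C) ≡ q (B ⊕ C) xor q (A ⊕ C) xor q (A ⊕ B)
  quad-triangle {A} {B} {C} a b c
    rewrite lookup-⊕ A (B ⊕ C) u | lookup-⊕ A (B ⊕ C) v
          | lookup-⊕ B C u | lookup-⊕ B C v | lookup-⊕ A C u | lookup-⊕ A C v
          | lookup-⊕ A B u | lookup-⊕ A B v = begin
    lhs                          ≡⟨ identity (L A u) (L A v) (L B u) (L B v) (L C u) (L C v) ⟩
    -- The solver proves the identity with its diagonal correction; the hypotheses then remove the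
    -- correction.
    rhs xor q A xor q B xor q C  ≡⟨ cong (rhs xor_) (cong₂ _xor_ a (cong₂ _xor_ b c)) ⟩
    rhs xor false                ≡⟨ xor-identityʳ rhs ⟩
    rhs                          ∎
    where
    open ≡-Reasoning
    open xor-∧-Solver
    L = Vec.lookup
    lhs rhs : Bool
    lhs = (L A u xor L B u xor L C u) ∧ (L A v xor L B v xor L C v)
    rhs = (L B u xor L C u) ∧ (L B v xor L C v) xor (L A u xor L C u) ∧ (L A v xor L C v)
          xor (L A u xor L B u) ∧ (L A v xor L B v)
    identity : ∀ a a′ b b′ c c′ →
      (a xor b xor c) ∧ (a′ xor b′ xor c′) ≡
      ((b xor c) ∧ (b′ xor c′) xor (a xor c) ∧ (a′ xor c′) xor (a xor b) ∧ (a′ xor b′))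
      xor a ∧ a′ xor b ∧ b′ xor c ∧ c′
    identity = solve 6 (λ a a′ b b′ c c′ →
      (a :+ (b :+ c)) :* (a′ :+ (b′ :+ c′)) :=
      ((b :+ c) :* (b′ :+ c′) :+ ((a :+ c) :* (a′ :+ c′) :+ (a :+ b) :* (a′ :+ b′)))
      :+ (a :* a′ :+ (b :* b′ :+ c :* c′))) refl

  -- Put D = A ⊕ B ⊕ C. Both sides reduce to `q V` plus the mixed products of V and D: on the left
  -- `q V` occurs three times, on the right the two copies of `q D` cancel. What is left over is
  -- `q A xor q B xor q C`. The trailing `xor false` matches `parity` unfolded on explicit lists.
  quad-claw : ∀ {V A B C : Subset n} → q A ≡ false → q B ≡ false → q C ≡ false →
              q (V ⊕ A) xor q (V ⊕ B) xor q (V ⊕ C) xor false ≡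
              q (V ⊕ A ⊕ B ⊕ C) xor q (A ⊕ B ⊕ C) xor false
  quad-claw {V} {A} {B} {C} a b c
    rewrite lookup-⊕ V (A ⊕ B ⊕ C) u | lookup-⊕ V (A ⊕ B ⊕ C) v
          | lookup-⊕ A (B ⊕ C) u | lookup-⊕ A (B ⊕ C) v
          | lookup-⊕ B C u | lookup-⊕ B C v | lookup-⊕ V A u | lookup-⊕ V A v
          | lookup-⊕ V B u | lookup-⊕ V B v | lookup-⊕ V C u | lookup-⊕ V C v = begin
    lhs                          ≡⟨ identity (L V u) (L V v) (L A u) (L A v) (L B u) (L B v) (L C u) (L C v) ⟩
    rhs xor q A xor q B xor q C  ≡⟨ cong (rhs xor_) (cong₂ _xor_ a (cong₂ _xor_ b c)) ⟩
    rhs xor false                ≡⟨ xor-identityʳ rhs ⟩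
    rhs                          ∎
    where
    open ≡-Reasoning
    open xor-∧-Solver
    L = Vec.lookup
    lhs rhs : Bool
    lhs = (L V u xor L A u) ∧ (L V v xor L A v) xor (L V u xor L B u) ∧ (L V v xor L B v)
          xor (L V u xor L C u) ∧ (L V v xor L C v) xor false
    rhs = (L V u xor L A u xor L B u xor L C u) ∧ (L V v xor L A v xor L B v xor L C v)
          xor (L A u xor L B u xor L C u) ∧ (L A v xor L B v xor L C v) xor false
    identity : ∀ z z′ a a′ b b′ c c′ →
      (z xor a) ∧ (z′ xor a′) xor (z xor b) ∧ (z′ xor b′) xor (z xor c) ∧ (z′ xor c′) xor false ≡
      ((z xor a xor b xor c) ∧ (z′ xor a′ xor b′ xor c′)
       xor (a xor b xor c) ∧ (a′ xor b′ xor c′) xor false)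
      xor a ∧ a′ xor b ∧ b′ xor c ∧ c′
    identity = solve 8 (λ z z′ a a′ b b′ c c′ →
      (z :+ a) :* (z′ :+ a′) :+ ((z :+ b) :* (z′ :+ b′) :+ ((z :+ c) :* (z′ :+ c′) :+ con false)) :=
      ((z :+ (a :+ (b :+ c))) :* (z′ :+ (a′ :+ (b′ :+ c′)))
       :+ ((a :+ (b :+ c)) :* (a′ :+ (b′ :+ c′)) :+ con false))
      :+ (a :* a′ :+ (b :* b′ :+ c :* c′))) refl

-- Claws and cycles

-- Edges among `a`, `b`, `c` may be present: they are separate entries of the edge list and stay in
-- the family.
claw⇒c₂<numEdges : ∀ (G : Graph n) {x a b c} → a ≢ b → a ≢ c → b ≢ c →
                   Adj G x a → Adj G x b → Adj G x c → c₂ G < numEdges G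
claw⇒c₂<numEdges G {x} {a} {b} {c} a≢b a≢c b≢c xa xb xc = exchange G
  (orient x a ∷ orient x b ∷ orient x c ∷ [])
  (⁅ x ⁆ ⊕ ⁅ a ⁆ ⊕ ⁅ b ⁆ ⊕ ⁅ c ⁆ ∷ ⁅ a ⁆ ⊕ ⁅ b ⁆ ⊕ ⁅ c ⁆ ∷ [])
  ((a≢b ∘ orient-injectiveʳ ∷ a≢c ∘ orient-injectiveʳ ∷ []) ∷ (b≢c ∘ orient-injectiveʳ ∷ []) ∷ [] ∷ [])
  (orient-∈-edges G xa ∷ orient-∈-edges G xb ∷ orient-∈-edges G xc ∷ [])
  (λ u v u≢v → ≡-trans
    (cong₂ _xor_ (quad-pair-orient (adj⇒≢ G xa) u v)
      (cong₂ _xor_ (quad-pair-orient (adj⇒≢ G xb) u v)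
        (cong (_xor false) (quad-pair-orient (adj⇒≢ G xc) u v))))
    (quad-claw {V = ⁅ x ⁆} (quad-⁅⁆ a u≢v) (quad-⁅⁆ b u≢v) (quad-⁅⁆ c u≢v)))
  ℕ.≤-refl

-- Stopping at a position lets a cycle closed by a chord into the middle of a path be treated
-- without truncating the path.
edgesTo : (xs : List (Fin n)) → Fin (length xs) → List (Fin n × Fin n)
edgesTo (x ∷ xs)     zero    = []
edgesTo (x ∷ y ∷ ys) (suc j) = orient x y ∷ edgesTo (y ∷ ys) j

fan : Fin n → (xs : List (Fin n)) → Fin (length xs) → List (Subset n)
fan a (x ∷ xs)     zero    = []
fan a (x ∷ y ∷ ys) (suc j) = ⁅ a ⁆ ⊕ ⁅ x ⁆ ⊕ ⁅ y ⁆ ∷ fan a (y ∷ ys) j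

length-fan : ∀ (a : Fin n) xs j → length (fan a xs j) ≡ length (edgesTo xs j)
length-fan a (x ∷ xs)     zero    = refl
length-fan a (x ∷ y ∷ ys) (suc j) = cong suc (length-fan a (y ∷ ys) j)

-- Path edges have both ends in `xs`, whereas the end `a` lies outside.
orient-∉-edgesTo : ∀ {a w : Fin n} xs j → All (a ≢_) xs → All (orient a w ≢_) (edgesTo xs j)
orient-∉-edgesTo (x ∷ xs)     zero    _                    = []
orient-∉-edgesTo (x ∷ y ∷ ys) (suc j) (a≢x ∷ a≢ys@(a≢y ∷ _)) = ≢ ∷ orient-∉-edgesTo (y ∷ ys) j a≢ys
  where
  ≢ : orient _ _ ≢ orient x y
  ≢ eq with orient-injective eq
  ... | inj₁ (a≡x , _) = a≢x a≡x
  ... | inj₂ (a≡y , _) = a≢y a≡y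

edgesTo-unique : ∀ {xs : List (Fin n)} → Unique xs → ∀ j → Unique (edgesTo xs j)
edgesTo-unique {xs = x ∷ xs}     _        zero    = []
edgesTo-unique {xs = x ∷ y ∷ ys} (x≢ ∷ u) (suc j) =
  orient-∉-edgesTo (y ∷ ys) j x≢ ∷ edgesTo-unique u j

module _ (G : Graph n) where

  edgesTo-∈-edges : ∀ {xs} → Linked (Adj G) xs → ∀ j → All (_∈ edges G) (edgesTo xs j)
  edgesTo-∈-edges {_ ∷ _} _       zero    = []
  edgesTo-∈-edges         (a ∷ l) (suc j) = orient-∈-edges G a ∷ edgesTo-∈-edges l j

  -- A telescoping sum: the triangle on `a`, `x`, `y` is the edge `xy` plus the spokes `ax` and
  -- `ay`, and consecutive triangles share a spoke, which cancels. Only the first and last spokes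
  -- survive.
  parity-fan : ∀ a {x xs} → Linked (Adj G) (x ∷ xs) → ∀ j {u v} → u ≢ v →
    quad (⁅ a ⁆ ⊕ ⁅ lookup (x ∷ xs) j ⁆) u v xor quad (⁅ a ⁆ ⊕ ⁅ x ⁆) u v
      xor parity (map pair (edgesTo (x ∷ xs) j)) u v
    ≡ parity (fan a (x ∷ xs) j) u v
  -- With no triangles the first and last spokes coincide and cancel.
  parity-fan a {x} _ zero {u} {v} _ = identity (quad (⁅ a ⁆ ⊕ ⁅ x ⁆) u v)
    where
    identity : ∀ p → p xor p xor false ≡ false
    identity false = refl
    identity true  = refl
  parity-fan a {x} {y ∷ ys} (xy ∷ l) (suc j) {u} {v} u≢v = begin
    q a z xor q a x xor quad (pair (orient x y)) u v xor rest
      ≡⟨ cong (λ e → q a z xor q a x xor e xor rest) (quad-pair-orient (adj⇒≢ G xy) u v) ⟩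
    q a z xor q a x xor q x y xor rest
      -- The spoke `ay` is inserted twice, to complete the triangle and to open the remaining fan.
      ≡⟨ identity (q a z) (q a x) (q x y) (q a y) rest ⟩
    (q x y xor q a y xor q a x) xor q a z xor q a y xor rest
      ≡⟨ cong₂ _xor_
           (sym (quad-triangle {A = ⁅ a ⁆} (quad-⁅⁆ a u≢v) (quad-⁅⁆ x u≢v) (quad-⁅⁆ y u≢v)))
           (parity-fan a l j u≢v) ⟩
    parity (fan a (x ∷ y ∷ ys) (suc j)) u v ∎
    where
    open ≡-Reasoning
    open xor-∧-Solver
    z = lookup (y ∷ ys) j
    rest = parity (map pair (edgesTo (y ∷ ys) j)) u v
    q : Fin n → Fin n → Bool
    q s t = quad (⁅ s ⁆ ⊕ ⁅ t ⁆) u v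
    identity : ∀ l p r s t → l xor p xor r xor t ≡ (r xor s xor p) xor l xor s xor t
    identity = solve 5 (λ l p r s t →
      l :+ (p :+ (r :+ t)) := (r :+ (s :+ p)) :+ (l :+ (s :+ t))) refl

  -- `xs` begins two steps after `a`, so the closing edge completes a cycle of length at least
  -- three. Its far end has position `suc j` in `x ∷ xs`.
  cycle⇒c₂<numEdges : ∀ {a x xs} → Linked (Adj G) (a ∷ x ∷ xs) → Unique (a ∷ x ∷ xs) →
                      ∀ j → Adj G a (lookup xs j) → c₂ G < numEdges G
  cycle⇒c₂<numEdges {a} {x} {xs} (ax ∷ l) (a≢ ∷ un@(x≢ ∷ _)) j ay = exchange G
    (orient a (lookup xs j) ∷ orient a x ∷ edgesTo (x ∷ xs) (suc j))
    (fan a (x ∷ xs) (suc j))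
    -- The two edges at `a` differ in their other ends, and neither is a path edge because `a` is
    -- not on `x ∷ xs`.
    ((All.lookup x≢ (∈-lookup j) ∘ sym ∘ orient-injectiveʳ ∷ orient-∉-edgesTo (x ∷ xs) (suc j) a≢)
      ∷ orient-∉-edgesTo (x ∷ xs) (suc j) a≢ ∷ edgesTo-unique un (suc j))
    (orient-∈-edges G ay ∷ orient-∈-edges G ax ∷ edgesTo-∈-edges l (suc j))
    (λ u v u≢v → ≡-trans
      (cong₂ _xor_ (quad-pair-orient (adj⇒≢ G ay) u v)
        (cong (_xor parity (map pair (edgesTo (x ∷ xs) (suc j))) u v) (quad-pair-orient (adj⇒≢ G ax) u v)))
      (parity-fan a l (suc j) u≢v))
    -- The fan has two sets fewer than there are edges; strict inequality takes one of the two.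
    (s≤s (subst (_≤ suc (length (edgesTo (x ∷ xs) (suc j))))
                (sym (length-fan a (x ∷ xs) (suc j))) (ℕ.n≤1+n _)))

-- Maximal paths

_∈?_ : ∀ (x : Fin n) xs → Dec (x ∈ xs)
_∈?_ = DecMembership._∈?_ Fin._≟_

lookup-injective : ∀ {xs : List (Fin n)} → Unique xs → ∀ {i j} → lookup xs i ≡ lookup xs j → i ≡ j
lookup-injective (x≢ ∷ u) {zero}  {zero}  _  = refl
lookup-injective (x≢ ∷ u) {zero}  {suc j} eq = contradiction eq (All.lookup x≢ (∈-lookup j))
lookup-injective (x≢ ∷ u) {suc i} {zero}  eq = contradiction (sym eq) (All.lookup x≢ (∈-lookup i))
lookup-injective (x≢ ∷ u) {suc i} {suc j} eq = cong suc (lookup-injective u eq)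

unique⇒length≤ : ∀ {xs : List (Fin n)} → Unique xs → length xs ≤ n
unique⇒length≤ u = Fin.injective⇒≤ (lookup-injective u)

module _ (G : Graph n) where

  linked⇒adj : ∀ {xs} → Linked (Adj G) xs → ∀ i j → toℕ j ≡ suc (toℕ i) →
               Adj G (lookup xs i) (lookup xs j)
  linked⇒adj (a ∷ _) zero    (suc zero)    _  = a
  linked⇒adj (_ ∷ l) (suc i) (suc j)       eq = linked⇒adj l i j (ℕ.suc-injective eq)

  head-connected : ∀ {x xs y} → Linked (Adj G) (x ∷ xs) → y ∈ x ∷ xs → Star (Adj G) x y
  head-connected _       (here refl) = ε
  head-connected (a ∷ l) (there y∈)  = a ◅ head-connected l y∈

  linked-connected : ∀ {xs x y} → Linked (Adj G) xs → x ∈ xs → y ∈ xs → Star (Adj G) x y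
  linked-connected {_ ∷ _} l x∈ y∈ =
    reverse (adj-sym G) (head-connected l x∈) ◅◅ head-connected l y∈

  -- No edge leaves the list. A closed path therefore fills a whole component.
  Closed : List (Fin n) → Set
  Closed xs = ∀ {x y} → x ∈ xs → Adj G x y → y ∈ xs

  closed-under-star : ∀ {xs} → Closed xs → ∀ {x y} → x ∈ xs → Star (Adj G) x y → y ∈ xs
  closed-under-star closed x∈ ε        = x∈
  closed-under-star closed x∈ (a ◅ as) = closed-under-star closed (closed x∈ a) as

  PathThrough : Fin n → List (Fin n) → Set
  PathThrough v xs = Linked (Adj G) xs × Unique xs × v ∈ xs

  module _ (tight : ¬ c₂ G < numEdges G) where

    -- Dropping vertices before position `i` makes it the head; an edge from there to a position two
    -- or more further on would close a cycle.
    chordless : ∀ {xs} → Linked (Adj G) xs → Unique xs → ∀ i j → toℕ i < toℕ j →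
                Adj G (lookup xs i) (lookup xs j) → toℕ j ≡ suc (toℕ i)
    chordless (_ ∷ _)   _       zero    (suc zero)    _         _ = refl
    chordless l@(_ ∷ _) u       zero    (suc (suc j)) _         a =
      contradiction (cycle⇒c₂<numEdges G l u j a) tight
    chordless (_ ∷ l)   (_ ∷ u) (suc i) (suc j)       (s≤s i<j) a =
      cong suc (chordless l u i j i<j a)

    -- The neighbour `x` of `w` must be an end of the path, since an inner vertex would have two
    -- path neighbours and `w`, forming a claw.
    extend : ∀ {xs w x} → Linked (Adj G) xs → Unique xs → w ∉ xs → x ∈ xs → Adj G w x →
             Linked (Adj G) (w ∷ xs) ⊎ Linked (Adj G) (xs ++ [ w ])
    extend l       _        _   (here refl) wx = inj₁ (wx ∷ l)
    extend (xy ∷ l) (x≢ ∷ u) w∉ (there x∈)  wx with extend l u (w∉ ∘ there) x∈ wx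
    ... | inj₂ l∷ʳw             = inj₂ (xy ∷ l∷ʳw)
    -- The tail is a single vertex, so `w` in front of the tail becomes `w` at the end of the whole
    -- path.
    ... | inj₁ (wy ∷ [-])       = inj₂ (xy ∷ adj-sym G wy ∷ [-])
    -- The tail's head `y` is an inner vertex adjacent to its predecessor, to its successor and to
    -- `w`.
    ... | inj₁ (wy ∷ (yz ∷ _))  = contradiction
      (claw⇒c₂<numEdges G (All.lookup x≢ (there (here refl)))
        (w∉ ∘ here ∘ sym) (w∉ ∘ there ∘ there ∘ here ∘ sym)
        (adj-sym G xy) yz (adj-sym G wy))
      tight

    -- Each extension adds a vertex and spends one unit of fuel, preserving the bound. Fuel cannot
    -- run out, as a path has at most `n` vertices.
    maximalPath : ∀ {v} fuel xs → n < length xs + fuel → PathThrough v xs →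
                  ∃ λ ys → PathThrough v ys × Closed ys
    maximalPath zero xs n< (_ , u , _) =
      contradiction (subst (n <_) (ℕ.+-identityʳ _) n<) (ℕ.≤⇒≯ (unique⇒length≤ u))
    maximalPath (suc fuel) xs n< p@(l , u , v∈)
      -- The search covers neighbours of all path vertices, not just of the ends, so failure gives
      -- `Closed` directly.
      with Fin.any? (λ w → ¬? (w ∈? xs) ×-dec Any.any? (adj? G w) xs)
    ... | no  none = xs , p , λ {x} {y} x∈ a → decidable-stable (y ∈? xs) λ y∉ →
          none (y , y∉ , lose x∈ (adj-sym G a))
    ... | yes (w , w∉ , any) with find any
    ...   | x , x∈ , wx with extend l u w∉ x∈ wx
    ...     | inj₁ w∷l = maximalPath fuel (w ∷ xs) (subst (n <_) (ℕ.+-suc _ fuel) n<)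
                           (w∷l , ¬Any⇒All¬ xs w∉ ∷ u , there v∈)
    ...     | inj₂ l∷ʳw = maximalPath fuel (xs ++ [ w ])
                           (subst (n <_) (≡-trans (sym (ℕ.+-assoc (length xs) 1 fuel))
                                            (cong (_+ fuel) (sym (length-++ xs)))) n<)
                           (l∷ʳw , Unique.++⁺ u ([] ∷ []) (λ { (w∈ , here refl) → w∉ w∈ }) , ∈-++⁺ˡ v∈)

    -- Positions on a maximal path give the isomorphism: closedness and connectedness identify the
    -- component, `Linked` and `chordless` the adjacencies.
    linearForest : IsLinearForest G
    linearForest v with maximalPath n [ v ] ℕ.≤-refl ([-] , [] ∷ [] , here refl)
    ... | xs , (l , u , v∈) , closed = length xs , record
      { to        = lookup xs
      ; injective = lookup-injective u
      ; image     = λ w → mk⇔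
          (λ v⋆w → let w∈ = closed-under-star closed v∈ v⋆w in Any.index w∈ , sym (lookup-index w∈))
          (λ { (i , refl) → linked-connected l v∈ (∈-lookup i) })
      ; adjacency = λ i j → mk⇔ (consecutive⇒adj i j) (adj⇒consecutive i j)
      }
      where
      consecutive⇒adj : ∀ i j → Adj (pathGraph (length xs)) i j → Adj G (lookup xs i) (lookup xs j)
      consecutive⇒adj i j (inj₁ eq) = linked⇒adj l i j eq
      consecutive⇒adj i j (inj₂ eq) = adj-sym G (linked⇒adj l j i eq)

      adj⇒consecutive : ∀ i j → Adj G (lookup xs i) (lookup xs j) → Adj (pathGraph (length xs)) i j
      adj⇒consecutive i j a with Fin.<-cmp i j
      ... | tri< i<j _ _  = inj₁ (chordless l u i j i<j a)
      ... | tri≈ _ refl _ = contradiction a (adj-irrefl G refl)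
      ... | tri> _ _ j<i  = inj₂ (chordless l u j i j<i (adj-sym G a))

theorem3p3 : ∀ (n : ℕ) (G : Graph n) → ¬ IsLinearForest G → c₂ G + 1 ≤ numEdges G
-- Since `<` on naturals is decidable, refuting its negation suffices, and that negation is `tight`.
theorem3p3 n G ¬lf = subst (_≤ numEdges G) (ℕ.+-comm 1 (c₂ G))
  (decidable-stable (c₂ G ℕ.<? numEdges G) (¬lf ∘ linearForest G))
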